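{- There exist an abduction frame $\langle F,I,C\rangle$ and a set of propositional variables $R$ such that no propositional formula $G$ satisfies $\mathrm{focus}(\langle F,I,C\rangle,R)=\mathrm{abduct}(\langle G,I\cap R,C\cap R\rangle)$ and no propositional formula $G$ satisfies $\mathrm{summarize}(\langle F,I,C\rangle,R)=\mathrm{abduct}(\langle G,I\cap R,C\cap R\rangle)$.
   Context: Propositional formulae may contain arbitrary propositional variables. A set of variables is read as the set (conjunction) of the corresponding positive literals. An explanation over a set of variables $I$ (hypotheses) and a set of variables $C$ (manifestations) is a pair of sets $E\subseteq I$, $M\subseteq C$ with $M\neq\emptyset$, written $E\Rightarrow M$. An abduction frame is a triple $\langle F,I,C\rangle$ where $F$ is a propositional formula and $I,C$ are disjoint sets of variables. It supports an explanation $E\Rightarrow M$ over $I$ and $C$ if $F\cup E$ is consistent and entails $M$ (every $m\in M$). The set of explanations it supports is $\mathrm{abduct}(\langle F,I,C\rangle)$. For a set of variables $R$ (the variables to remember): $\mathrm{focus}(\langle F,I,C\rangle,R)$ is the set of all $E\Rightarrow M$ with $E\subseteq I\cap R$, $M\subseteq C\cap R$, $M\neq\emptyset$, such that there exist $E'\subseteq I\setminus R$ and $M'\subseteq C\setminus R$ with $(E\cup E')\Rightarrow(M\cup M')\in\mathrm{abduct}(\langle F,I,C\rangle)$; $\mathrm{summarize}(\langle F,I,C\rangle,R)$ is the set of all $E\Rightarrow M$ with $E\subseteq I\cap R$, $M\subseteq C\cap R$, such that there exists $E'\subseteq I\setminus R$ with $(E\cup E')\Rightarrow M\in\mathrm{abduct}(\langle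 F,I,C\rangle)$. -}

module Defs where

open import Data.Bool.Base using (Bool; true; false; not; _∧_; _∨_)
open import Data.Nat.Base using (ℕ)
open import Data.Product.Base using (_×_; _,_; ∃-syntax; Σ-syntax)
open import Level using (Level; 0ℓ; suc)
open import Relation.Binary.PropositionalEquality.Core using (_≡_)
open import Relation.Unary using
  (Pred; _∈_; _⊆_; _∩_; _∪_; _∖_; _⊥_; ｛_｝; Satisfiable)

Var : Set
Var = ℕ

VarSet : Set₁
VarSet = Pred Var 0ℓ

infix  9 `¬_
infixr 8 _`∧_
infixr 7 _`∨_
infixr 6 _`→_

data Formula : Set where
  var            : Var → Formula
  `⊤ `⊥          : Formula
  `¬_            : Formula → Formula
  _`∧_ _`∨_ _`→_ : Formula → Formula → Formula

Valuation : Set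
Valuation = Var → Bool

eval : Valuation → Formula → Bool
eval ν (var x)  = ν x
eval ν `⊤       = true
eval ν `⊥       = false
eval ν (`¬ φ)   = not (eval ν φ)
eval ν (φ `∧ ψ) = eval ν φ ∧ eval ν ψ
eval ν (φ `∨ ψ) = eval ν φ ∨ eval ν ψ
eval ν (φ `→ ψ) = not (eval ν φ) ∨ eval ν ψ

Theory : Set₁
Theory = Pred Formula 0ℓ

_IsModelOf_ : Valuation → Theory → Set
ν IsModelOf Γ = ∀ φ → φ ∈ Γ → eval ν φ ≡ true

Consistent : Theory → Set
Consistent Γ = ∃[ ν ] ν IsModelOf Γ

infix 4 _⊨_

_⊨_ : Theory → Formula → Set
Γ ⊨ φ = ∀ ν → ν IsModelOf Γ → eval ν φ ≡ true

literals : VarSet → Theory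
literals X φ = ∃[ x ] x ∈ X × φ ≡ var x

infix 5 _⇒_

-- The side conditions relative to hypotheses I and manifestations C are
-- imposed by IsExplanation.
record Explanation : Set₁ where
  constructor _⇒_
  field
    hyps : VarSet
    mans : VarSet

IsExplanation : VarSet → VarSet → Pred Explanation 0ℓ
IsExplanation I C (E ⇒ M) = E ⊆ I × M ⊆ C × Satisfiable M

record Frame : Set₁ where
  constructor frame
  field
    F        : Formula
    I        : VarSet
    C        : VarSet
    disjoint : I ⊥ C

open Frame

Supports : Frame → Pred Explanation 0ℓ
Supports A (E ⇒ M) =
  Consistent (｛ F A ｝ ∪ literals E) ×
  (∀ m → m ∈ M → (｛ F A ｝ ∪ literals E) ⊨ var m)

abduct : Frame → Pred Explanation 0ℓ
abduct A = IsExplanation (I A) (C A) ∩ Supports A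

focus : Frame → VarSet → Pred Explanation (suc 0ℓ)
focus A R (E ⇒ M) =
  E ⊆ I A ∩ R × M ⊆ C A ∩ R × Satisfiable M ×
  (Σ[ E′ ∈ VarSet ] Σ[ M′ ∈ VarSet ]
     E′ ⊆ I A ∖ R × M′ ⊆ C A ∖ R × (E ∪ E′ ⇒ M ∪ M′) ∈ abduct A)

summarize : Frame → VarSet → Pred Explanation (suc 0ℓ)
summarize A R (E ⇒ M) =
  E ⊆ I A ∩ R × M ⊆ C A ∩ R ×
  (Σ[ E′ ∈ VarSet ] E′ ⊆ I A ∖ R × (E ∪ E′ ⇒ M) ∈ abduct A)

∩-disjoint : (X Y R : VarSet) → X ⊥ Y → (X ∩ R) ⊥ (Y ∩ R)
∩-disjoint X Y R X⊥Y ((x∈X , _) , (x∈Y , _)) = X⊥Y (x∈X , x∈Y)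

{-# OPTIONS --safe #-}
module Submission where

-- The sets of explanations of the form abduct A are closed under joining
-- manifestations: if E entails M and E entails N, then E entails M ∪ N.
-- Neither focusing nor summarizing keeps this closure, because a forgotten
-- hypothesis may differ from one explanation to the next.
--
-- The witness has hypotheses a, b, manifestations p, q and the formula
-- (a → p) ∧ (b → q) ∧ ¬ (a ∧ b), and it remembers p and q only.  Forgetting a
-- and b turns {a} ⇒ {p} and {b} ⇒ {q} into ∅ ⇒ {p} and ∅ ⇒ {q}.  However,
-- ∅ ⇒ {p , q} does not survive: a set of hypotheses consistent with the
-- formula cannot contain both a and b, hence it does not entail both p and q
-- (lemma not-jointly-explained).
--
-- Since summarize is included in focus, both claims follow from one fact: no
-- set of explanations between summarize and focus is of the form abduct A
-- (lemma not-sandwiched).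

open import Defs
open import Data.Bool.Base using (true; false; not; _∨_)
open import Data.Nat.Base using (_≡ᵇ_)
open import Data.Product.Base using (_×_; _,_; Σ-syntax; ∃-syntax)
open import Data.Sum.Base using (inj₁; inj₂; [_,_]; [_,_]′)
open import Function.Base using (id)
open import Relation.Binary.PropositionalEquality.Core using (_≡_; refl; sym; trans)
open import Relation.Nullary.Negation.Core using (¬_; contradiction)
open import Relation.Unary using
  (Pred; _∈_; _∉_; _⊆_; _≐_; _∩_; _∪_; _⊥_; ∅; ｛_｝)

model⁺ : ∀ {ν φ X} → eval ν φ ≡ true → (∀ {x} → x ∈ X → ν x ≡ true) →
         ν IsModelOf (｛ φ ｝ ∪ literals X)
model⁺ νφ νX _ (inj₁ refl)             = νφ
model⁺ νφ νX _ (inj₂ (_ , x∈X , refl)) = νX x∈X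

model-formula : ∀ {ν φ X} → ν IsModelOf (｛ φ ｝ ∪ literals X) → eval ν φ ≡ true
model-formula ν⊨ = ν⊨ _ (inj₁ refl)

model-literal : ∀ {ν φ X x} → ν IsModelOf (｛ φ ｝ ∪ literals X) →
                x ∈ X → ν x ≡ true
model-literal ν⊨ x∈X = ν⊨ _ (inj₂ (_ , x∈X , refl))

-- The closure property that focusing and summarizing destroy.
abduct-∪ : ∀ A {E M N} → (E ⇒ M) ∈ abduct A → (E ⇒ N) ∈ abduct A →
           (E ⇒ M ∪ N) ∈ abduct A
abduct-∪ A ((E⊆I , M⊆C , m , m∈M) , con , ⊨M) ((_ , N⊆C , _) , _ , ⊨N) =
  (E⊆I , [ M⊆C , N⊆C ]′ , m , inj₁ m∈M) , con , λ n → [ ⊨M n , ⊨N n ]′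

-- The set of added forgotten manifestations may be taken empty.
summarize⊆focus : ∀ A R {e} → e ∈ summarize A R → e ∈ focus A R
summarize⊆focus A R
  (E⊆ , M⊆ , E′ , E′⊆ , (E∪E′⊆I , M⊆C , m , m∈M) , con , ⊨M) =
  E⊆ , M⊆ , (m , m∈M) , E′ , ∅ , E′⊆ , (λ ()) ,
  (E∪E′⊆I , [ M⊆C , (λ ()) ] , m , inj₁ m∈M) , con ,
  λ n → [ ⊨M n , (λ ()) ]

-- The variables of the witness.
a b p q : Var
a = 0
b = 1
p = 2
q = 3

-- Each hypothesis has its own manifestation, and the hypotheses exclude each
-- other.
exclusive : Formula
exclusive = (var a `→ var p) `∧ (var b `→ var q) `∧ (`¬ (var a `∧ var b))

hypotheses manifestations : VarSet
hypotheses     = ｛ a ｝ ∪ ｛ b ｝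
manifestations = ｛ p ｝ ∪ ｛ q ｝

hypotheses⊥manifestations : hypotheses ⊥ manifestations
hypotheses⊥manifestations (inj₁ refl , inj₁ ())
hypotheses⊥manifestations (inj₁ refl , inj₂ ())
hypotheses⊥manifestations (inj₂ refl , inj₁ ())
hypotheses⊥manifestations (inj₂ refl , inj₂ ())

-- The set of variables to remember in this frame is always its set of
-- manifestations, so that exactly the two hypotheses are forgotten.
exclusiveFrame : Frame
exclusiveFrame =
  frame exclusive hypotheses manifestations hypotheses⊥manifestations

a⇒p : ∀ ν → eval ν exclusive ≡ true → ν a ≡ true → ν p ≡ true
a⇒p ν νF νa with ν a | ν p
a⇒p ν νF refl | true | true  = refl
a⇒p ν ()  refl | true | false

b⇒q : ∀ ν → eval ν exclusive ≡ true → ν b ≡ true → ν q ≡ true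
b⇒q ν νF νb with ν b | ν q | not (ν a) ∨ ν p
b⇒q ν νF refl | true | true  | _     = refl
b⇒q ν ()  refl | true | false | true
b⇒q ν ()  refl | true | false | false

exclusion : ∀ ν → eval ν exclusive ≡ true → ν a ≡ true → ν b ≡ true →
            false ≡ true
exclusion ν νF νa νb with ν a | ν b | ν p | ν q
exclusion ν () refl refl | true | true | true | true
exclusion ν () refl refl | true | true | true | false
exclusion ν () refl refl | true | true | false | _

-- The valuation in which exactly x and y are true.
pair : Var → Var → Valuation
pair x y z = (z ≡ᵇ x) ∨ (z ≡ᵇ y)

-- If h entails m under the formula, then forgetting h leaves an explanation
-- of m without hypotheses; the valuation pair h m shows consistency.
summarized : ∀ {h m} → h ∈ hypotheses → h ∉ manifestations →
             m ∈ manifestations →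
             eval (pair h m) exclusive ≡ true → pair h m h ≡ true →
             (∀ ν → eval ν exclusive ≡ true → ν h ≡ true → ν m ≡ true) →
             (∅ ⇒ ｛ m ｝) ∈ summarize exclusiveFrame manifestations
summarized {h} {m} h∈I h∉C m∈C νF νh h⇒m =
  (λ ()) , (λ { refl → m∈C , m∈C }) , ｛ h ｝ , (λ { refl → h∈I , h∉C }) ,
  ( [ (λ ()) , (λ { refl → h∈I }) ] , (λ { refl → m∈C }) , m , refl) ,
  (pair h m , model⁺ νF [ (λ ()) , (λ { refl → νh }) ]) ,
  λ { _ refl ν ν⊨ → h⇒m ν (model-formula ν⊨) (model-literal ν⊨ (inj₂ refl)) }

p-summarized : (∅ ⇒ ｛ p ｝) ∈ summarize exclusiveFrame manifestations
p-summarized =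
  summarized (inj₁ refl) (λ { (inj₁ ()) ; (inj₂ ()) }) (inj₁ refl) refl refl a⇒p

q-summarized : (∅ ⇒ ｛ q ｝) ∈ summarize exclusiveFrame manifestations
q-summarized =
  summarized (inj₂ refl) (λ { (inj₁ ()) ; (inj₂ ()) }) (inj₂ refl) refl refl b⇒q

-- Membership in E need not be decidable, so the case split
-- is on the value of a in a model ν of the formula and E.  If a is true in
-- ν, then b is not assumed, and the model with only a and p true refutes q; if a
-- is false in ν, then a is not assumed, and the model with only b and q true
-- refutes p.
not-jointly-explained : ∀ {E M} → E ⊆ hypotheses → p ∈ M → q ∈ M →
                        ¬ Supports exclusiveFrame (E ⇒ M)
not-jointly-explained {E} E⊆I p∈M q∈M ((ν , ν⊨) , ⊨M) = split (ν a) refl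
  where
  split : ∀ t → ν a ≡ t → _
  split true νa = contradiction (⊨M q q∈M (pair a p) (model⁺ refl true-on-E)) λ ()
    where
    true-on-E : ∀ {x} → x ∈ E → pair a p x ≡ true
    true-on-E x∈E with E⊆I x∈E
    ... | inj₁ refl = refl
    ... | inj₂ refl = exclusion ν (model-formula ν⊨) νa (model-literal ν⊨ x∈E)
  split false ¬νa = contradiction (⊨M p p∈M (pair b q) (model⁺ refl true-on-E)) λ ()
    where
    true-on-E : ∀ {x} → x ∈ E → pair b q x ≡ true
    true-on-E x∈E with E⊆I x∈E
    ... | inj₁ refl = trans (sym ¬νa) (model-literal ν⊨ x∈E)
    ... | inj₂ refl = refl

joint-not-focused : (∅ ⇒ ｛ p ｝ ∪ ｛ q ｝) ∉ focus exclusiveFrame manifestations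
joint-not-focused (_ , _ , _ , _ , _ , _ , _ , (E⊆I , _) , supported) =
  not-jointly-explained E⊆I (inj₁ (inj₁ refl)) (inj₁ (inj₂ refl)) supported

-- Taking S to be either end of the interval gives the two claims.
not-sandwiched : ∀ {ℓ} (S : Pred Explanation ℓ) A →
                 (∀ {e} → e ∈ summarize exclusiveFrame manifestations → e ∈ S) →
                 (∀ {e} → e ∈ S → e ∈ focus exclusiveFrame manifestations) →
                 ¬ (S ≐ abduct A)
not-sandwiched S A summarize⊆S S⊆focus (S⊆abduct , abduct⊆S) =
  joint-not-focused (S⊆focus (abduct⊆S (abduct-∪ A
    (S⊆abduct (summarize⊆S p-summarized))
    (S⊆abduct (summarize⊆S q-summarized)))))

theorem3 : Σ[ F ∈ Formula ] Σ[ I ∈ VarSet ] Σ[ C ∈ VarSet ] Σ[ I⊥C ∈ I ⊥ C ] Σ[ R ∈ VarSet ]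
    (¬ (∃[ G ] focus (frame F I C I⊥C) R ≐ abduct (frame G (I ∩ R) (C ∩ R) (∩-disjoint I C R I⊥C)))) ×
    (¬ (∃[ G ] summarize (frame F I C I⊥C) R ≐ abduct (frame G (I ∩ R) (C ∩ R) (∩-disjoint I C R I⊥C))))
theorem3 =
  exclusive , hypotheses , manifestations , hypotheses⊥manifestations , manifestations ,
  (λ (G , eq) → not-sandwiched (focus A R) (remembered G) (summarize⊆focus A R) id eq) ,
  (λ (G , eq) → not-sandwiched (summarize A R) (remembered G) id (summarize⊆focus A R) eq)
  where
  A = exclusiveFrame
  R = manifestations

  remembered : Formula → Frame
  remembered G = frame G (hypotheses ∩ R) (manifestations ∩ R)
    (∩-disjoint hypotheses manifestations R hypotheses⊥manifestations)
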